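{- There is a function $g:\mathbb{N}\to\mathbb{R}$ with $g(n)=o(n)$ such that the following holds. Let $n$ be a positive integer with $n\equiv 0 \pmod 3$, let $K$ be a complete graph of order $n$, and let $c:E(K)\to\{\pm 1\}$ be a balanced edge labeling of $K$. Then there is a $C_3$-factor $F$ of $K$ with $$m^+(F)\geq \left(\frac{3\sqrt{2}}{4}-\frac{1}{2}\right)n-g(n).$$
   Context: An edge labeling $c:E(K)\to\{\pm1\}$ is balanced if the number of edges with label $+1$ (plus-edges) equals the number of edges with label $-1$. A $C_3$-factor of $K$ is a spanning subgraph of $K$ each of whose components is a triangle. For a subgraph $H$ of $K$, $m^+(H)$ denotes the number of plus-edges of $H$. The $o(n)$ term (the function $g$) does not depend on $K$ or $c$. -}

module Defs where

open import Data.Nat using (ℕ; _+_; _*_)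
open import Data.Bool using (Bool; true; false; if_then_else_; _∧_)
open import Data.Fin using (Fin; zero; suc; _<?_)
open import Data.List using (List; map; allFin)
open import Data.Nat.ListAction using (sum)
open import Relation.Binary.PropositionalEquality using (_≡_)
open import Data.Product using (_×_; _,_)
open import Relation.Nullary.Decidable using (isYes)
open import Function.Bundles using (_⤖_; Bijection)
import Data.Bool as B

-- An edge labeling of the complete graph K_n on vertex set Fin n.
-- true = label +1, false = label -1.  Only the values c i j with i ≠ j
-- matter; symmetry (c i j ≡ c j i) is imposed as a hypothesis in the statement.
Labeling : ℕ → Set
Labeling n = Fin n → Fin n → Bool

ind : Bool → ℕ
ind b = if b then 1 else 0

edgeCount : ∀ {n} → Labeling n → Bool → ℕ
edgeCount {n} c b =
  sum (map (λ i → sum (map (λ j → ind (isYes (i <? j) ∧ isYes (c i j B.≟ b)))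
                            (allFin n)))
           (allFin n))

Balanced : ∀ {n} → Labeling n → Set
Balanced c = edgeCount c true ≡ edgeCount c false

-- A C3-factor of K_n with n = 3m: a bijection between Fin m × Fin 3
-- (m triangles, each with 3 corners) and the vertex set Fin n.
-- Triangle k has vertices F(k,0), F(k,1), F(k,2); all pairs among them
-- are edges of the complete graph K_n.
C3Factor : ℕ → ℕ → Set
C3Factor m n = (Fin m × Fin 3) ⤖ Fin n

plusTriangle : ∀ {m n} → Labeling n → C3Factor m n → Fin m → ℕ
plusTriangle c F k =
  ind (c (v zero) (v (suc zero))) +
  ind (c (v zero) (v (suc (suc zero)))) +
  ind (c (v (suc zero)) (v (suc (suc zero))))
  where
  v : Fin 3 → _
  v t = Bijection.to F (k , t)

plusEdges : ∀ {m n} → Labeling n → C3Factor m n → ℕ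
plusEdges {m} c F = sum (map (plusTriangle c F) (allFin m))

{-# OPTIONS --safe #-}

-- Let p(T) be the number of plus-edges of a triangle T and w(T) = min(p(T), 2). Take a factor whose potential
-- Σ (p + w) is not increased by any one or two successive exchanges of vertices. For two of its triangles T, U
-- the nine exchanges of a vertex of T with one of U bound the number e(T,U) of plus-edges between them by
--   4 e(T,U) + 9 w(T) w(U) ≤ 4 p(T) w(U) + 4 p(U) w(T) + 6 w(T) + 6 w(U),
-- as one sees by inspecting all labelings of K₆. The inequality fails, by at most 4, only if p(U) = 1 and several
-- vertices of T can complete U to a plus-triangle, or vice versa; by double exchanges each T has at most one such U.
-- Put P = Σ p and W = Σ w over the m triangles. Since Σ e(T,U) over ordered pairs is about 9 m² / 2,
--   18 m² + 9 W² ≤ 8 P W + 12 m W + O(m),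
-- and AM-GM on the left-hand side yields (8 P + 12 m + O(1))² ≥ 648 m², with an error term g that is even constant.
module Submission where

open import Defs
open import Data.Nat using (ℕ; suc; _+_; _*_; _≤_)
open import Data.Bool using (Bool)
open import Data.Fin using (Fin)
open import Data.Product using (Σ; _×_; ∃)
open import Relation.Binary.PropositionalEquality using (_≡_)

import Algebra.Properties.Semiring.Sum
open import Data.Bool using (true; false; if_then_else_; _∧_; _∨_; not; T)
import Data.Bool as Bool
open import Data.Bool.Properties using (T-∧; T-∨; T-≡; ∧-conicalˡ; ∧-conicalʳ)
open import Data.Fin using (zero; suc; combine; remQuot; _↑ʳ_)
import Data.Fin as Fin
open import Data.Fin.Patterns using (0F; 1F; 2F)
open import Data.Fin.Permutation using (Permutation)
import Data.Fin.Permutation as Perm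
open import Data.Fin.Permutation.Components using (transpose)
open import Data.Fin.Properties using (_≟_; *↔×; any?)
import Data.Fin.Properties as Finₚ
open import Data.List using (map; allFin; tabulate)
open import Data.List.Properties using (map-tabulate)
open import Data.Nat using (zero; _<_; _≤ᵇ_; _≡ᵇ_; z≤n; s≤s; _<?_)
import Data.Nat.ListAction as List
open import Data.Nat.Properties hiding (_≟_; _<?_)
open import Data.Nat.Tactic.RingSolver using (solve-∀)
open import Data.Product using (_,_; proj₁; proj₂)
open import Data.Product.Algebra using (×-comm)
open import Data.Sum using (inj₁; inj₂)
open import Data.Unit using (tt)
open import Data.Vec.Functional using (updateAt)
open import Data.Vec.Functional.Properties using (updateAt-updates; updateAt-minimal)
open import Function using (_∘_; const; id)
open import Function.Bundles using (Equivalence; Bijection)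
open import Function.Construct.Composition using (_⤖-∘_; _↔-∘_)
open import Function.Properties.Bijection using (⤖⇒↔)
open import Function.Properties.Inverse using (↔⇒⤖; ↔-sym)
open import Relation.Binary.PropositionalEquality using (_≢_; refl; sym; trans; cong; cong₂; subst; subst₂)
open import Relation.Nullary using (yes; no; does; contradiction)
open import Relation.Nullary.Decidable using (isYes)

open Algebra.Properties.Semiring.Sum +-*-semiring
  using (sum; sum-syntax; ∑-distrib-+; ∑-comm; sum-permute; sum-cong-≗; *-distribˡ-sum; *-distribʳ-sum)

-- Finite sums

ind≤1 : ∀ b → ind b ≤ 1
ind≤1 false = z≤n
ind≤1 true  = s≤s z≤n

∑-mono : ∀ {n} {f g : Fin n → ℕ} → (∀ i → f i ≤ g i) → sum f ≤ sum g
∑-mono {zero}  f≤g = z≤n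
∑-mono {suc n} f≤g = +-mono-≤ (f≤g zero) (∑-mono (f≤g ∘ suc))

∑-const : ∀ n x → ∑[ i < n ] x ≡ n * x
∑-const zero    x = refl
∑-const (suc n) x = cong (x +_) (∑-const n x)

single : ∀ {n} → Fin n → ℕ → Fin n → ℕ
single k x i = if does (k ≟ i) then x else 0

∑-single : ∀ {n} (k : Fin n) x → sum (single k x) ≡ x
∑-single {suc n} zero    x = trans (cong (x +_) (trans (∑-const n 0) (*-zeroʳ n))) (+-identityʳ x)
∑-single {suc n} (suc k) x = ∑-single k x

-- Serves to bound the number of switchable partners of a triangle, once they are known to be
-- unique.
∑-indicator-≤1 : ∀ {n} (r : Fin n → Bool) → (∀ i j → T (r i) → T (r j) → i ≡ j) →
                 ∑[ i < n ] ind (r i) ≤ 1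
∑-indicator-≤1 {zero}  r unique = z≤n
∑-indicator-≤1 {suc n} r unique with r zero in r₀
... | false = ∑-indicator-≤1 (r ∘ suc) λ i j p q → Finₚ.suc-injective (unique (suc i) (suc j) p q)
... | true  = ≤-reflexive (cong suc (trans (sum-cong-≗ absent) (trans (∑-const n 0) (*-zeroʳ n))))
  where
  absent : ∀ i → ind (r (suc i)) ≡ 0
  absent i with r (suc i) in rᵢ
  ... | false = refl
  ... | true  with () ← unique zero (suc i) (subst T (sym r₀) tt) (subst T (sym rᵢ) tt)

∑-combine : ∀ m {n} (f : Fin (m * n) → ℕ) → sum f ≡ ∑[ k < m ] ∑[ s < n ] f (combine k s)
∑-combine zero    f = refl
∑-combine (suc m) {n} f = trans (∑-splitAt n f) (cong (sum (λ s → f (s Fin.↑ˡ (m * n))) +_) (∑-combine m (f ∘ (n ↑ʳ_))))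
  where
  ∑-splitAt : ∀ a {b} (g : Fin (a + b) → ℕ) → sum g ≡ ∑[ i < a ] g (i Fin.↑ˡ b) + ∑[ j < b ] g (a ↑ʳ j)
  ∑-splitAt zero    g = refl
  ∑-splitAt (suc a) g = trans (cong (g zero +_) (∑-splitAt a (g ∘ suc))) (sym (+-assoc (g zero) _ _))

sum-allFin : ∀ {n} (f : Fin n → ℕ) → List.sum (map f (allFin n)) ≡ sum f
sum-allFin f = trans (cong List.sum (map-tabulate id f)) (sum-tabulate f)
  where
  sum-tabulate : ∀ {n} (f : Fin n → ℕ) → List.sum (tabulate f) ≡ sum f
  sum-tabulate {zero}  f = refl
  sum-tabulate {suc n} f = cong (f zero +_) (sum-tabulate (f ∘ suc))

∑∑-distrib-+ : ∀ {m n} (f g : Fin m → Fin n → ℕ) →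
  ∑[ i < m ] ∑[ j < n ] (f i j + g i j) ≡ ∑[ i < m ] ∑[ j < n ] f i j + ∑[ i < m ] ∑[ j < n ] g i j
∑∑-distrib-+ f g = trans (sum-cong-≗ λ i → ∑-distrib-+ (f i) (g i)) (∑-distrib-+ (sum ∘ f) (sum ∘ g))

∑∑-*ˡ : ∀ {m n} a (f : Fin m → Fin n → ℕ) → ∑[ i < m ] ∑[ j < n ] (a * f i j) ≡ a * ∑[ i < m ] ∑[ j < n ] f i j
∑∑-*ˡ a f = trans (sum-cong-≗ λ i → sym (*-distribˡ-sum a (f i))) (sym (*-distribˡ-sum a (sum ∘ f)))

∑∑-product : ∀ {m n} (f : Fin m → ℕ) (g : Fin n → ℕ) → ∑[ i < m ] ∑[ j < n ] (f i * g j) ≡ sum f * sum g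
∑∑-product f g = trans (sum-cong-≗ λ i → sym (*-distribˡ-sum (f i) g)) (sym (*-distribʳ-sum (sum g) f))

-- Six vertices: two triangles and the nine edges between them

weight : ℕ → ℕ
weight 0 = 0
weight 1 = 1
weight _ = 2

-- The values at 0, 1, 2, 3 are 0, 2, 4, 5: a third plus-edge earns half as much as each of the
-- first two.
φ : ℕ → ℕ
φ p = p + weight p

∑₃ : (Fin 3 → ℕ) → ℕ
∑₃ f = f 0F + f 1F + f 2F

all₃ any₃ : (Fin 3 → Bool) → Bool
all₃ P = P 0F ∧ P 1F ∧ P 2F
any₃ P = P 0F ∨ P 1F ∨ P 2F

-- a s is the edge opposite to corner s of a triangle, and x s the edge from corner s to the outer vertex
-- that replaces one of the corners.
replaced : (a x : Fin 3 → ℕ) → Fin 3 → ℕ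
replaced a x 0F = a 0F + x 1F + x 2F
replaced a x 1F = a 1F + x 2F + x 0F
replaced a x 2F = a 2F + x 0F + x 1F

-- Both ways to use the corners 0 and 1 of the other triangle are demanded, as the double exchange needs
-- distinct corners for two switchable triangles.
switchable : (b : Fin 3 → ℕ) (X : Fin 3 → Fin 3 → ℕ) → Bool
switchable b X = (∑₃ b ≡ᵇ 1) ∧ any₃ λ t → (replaced b (X 0F) t ≡ᵇ 3) ∧ (replaced b (X 1F) t ≡ᵇ 3)

-- Each summand splits into a factor for one triangle and a factor for the other (possibly
-- constant), so that its sum over all pairs is a product of total counts.
bound : (p q : ℕ) → ℕ
bound p q = 4 * (p * weight q) + 4 * (q * weight p) + 6 * weight p + 6 * weight q

swap-stable : (φ₀ : ℕ) (a b : Fin 3 → ℕ) (X : Fin 3 → Fin 3 → ℕ) → Bool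
swap-stable φ₀ a b X = all₃ λ s → all₃ λ t →
  φ (replaced a (λ s′ → X s′ t) s) + φ (replaced b (X s) t) ≤ᵇ φ₀

cross-bounded : (w r : ℕ) (a b : Fin 3 → ℕ) (X : Fin 3 → Fin 3 → ℕ) → Bool
cross-bounded w r a b X =
  4 * ∑₃ (λ s → ∑₃ (X s)) + w ≤ᵇ r + 4 * ind (switchable b X) + 4 * ind (switchable a λ t s → X s t)

-- Exhaustive search over the labelings of K₆

⟨_,_,_⟩ : ∀ {A : Set} → A → A → A → Fin 3 → A
⟨ x , y , z ⟩ 0F = x
⟨ x , y , z ⟩ 1F = y
⟨ x , y , z ⟩ 2F = z

-- Opaque, since otherwise every conversion check involving a search unfolds the search.
opaque
  bits : (ℕ → Bool) → Bool
  bits P = P 0 ∧ P 1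

  bits-elim : ∀ P → bits P ≡ true → ∀ b → P (ind b) ≡ true
  bits-elim P h false = ∧-conicalˡ (P 0) (P 1) h
  bits-elim P h true  = ∧-conicalʳ (P 0) (P 1) h

bits₃ : ((Fin 3 → ℕ) → Bool) → Bool
bits₃ P = bits λ x → bits λ y → bits λ z → P ⟨ x , y , z ⟩

leaf : (φ₀ w r : ℕ) (a b : Fin 3 → ℕ) (X : Fin 3 → Fin 3 → ℕ) → Bool
leaf φ₀ w r a b X = not (swap-stable φ₀ a b X) ∨ cross-bounded w r a b X

-- φ₀, w and r do not depend on x, y, z: as arguments they are evaluated once for all 512 leaves.
check-cross : (φ₀ w r : ℕ) (a b : Fin 3 → ℕ) → Bool
check-cross φ₀ w r a b = bits₃ λ x → bits₃ λ y → bits₃ λ z → leaf φ₀ w r a b ⟨ x , y , z ⟩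

check : (p q : ℕ) (a b : Fin 3 → ℕ) → Bool
check p q = check-cross (φ p + φ q) (9 * (weight p * weight q)) (bound p q)

opaque
  unfolding bits

  -- The 3 + 3 + 9 edges of K₆ have 2¹⁵ labelings; all are settled by evaluation, for which `bits`
  -- must unfold in this block.
  check-all : (bits₃ λ a → bits₃ λ b → check (∑₃ a) (∑₃ b) a b) ≡ true
  check-all = refl

T-not-∨ : ∀ {x y} → T (not x ∨ y) → T x → T y
T-not-∨ {true} y _ = y

all₃-intro : ∀ {P} → (∀ s → T (P s)) → T (all₃ P)
all₃-intro h = Equivalence.from T-∧ (h 0F , Equivalence.from T-∧ (h 1F , h 2F))

any₃-elim : ∀ P → T (any₃ P) → ∃ λ s → T (P s)
any₃-elim P h with Equivalence.to (T-∨ {P 0F}) h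
... | inj₁ p = 0F , p
... | inj₂ h with Equivalence.to (T-∨ {P 1F}) h
...   | inj₁ p = 1F , p
...   | inj₂ p = 2F , p

⟪_⟫ : (Fin 3 → Bool) → Fin 3 → ℕ
⟪ a ⟫ = ⟨ ind (a 0F) , ind (a 1F) , ind (a 2F) ⟩

bits₃-elim : ∀ P → bits₃ P ≡ true → ∀ a → P ⟪ a ⟫ ≡ true
bits₃-elim P h a = bits-elim (λ z → P ⟨ ind (a 0F) , ind (a 1F) , z ⟩)
  (bits-elim (λ y → bits λ z → P ⟨ ind (a 0F) , y , z ⟩)
    (bits-elim (λ x → bits λ y → bits λ z → P ⟨ x , y , z ⟩) h (a 0F)) (a 1F)) (a 2F)

cross-bound : ∀ (a b : Fin 3 → Bool) (X : Fin 3 → Fin 3 → Bool) →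
  let p = ∑₃ (ind ∘ a) ; q = ∑₃ (ind ∘ b) ; Y = λ s t → ind (X s t) in
  (∀ s t → φ (replaced (ind ∘ a) (λ s′ → Y s′ t) s) + φ (replaced (ind ∘ b) (Y s) t) ≤ φ p + φ q) →
  4 * ∑₃ (λ s → ∑₃ (Y s)) + 9 * (weight p * weight q) ≤
  bound p q + 4 * ind (switchable (ind ∘ b) Y) + 4 * ind (switchable (ind ∘ a) λ t s → Y s t)
cross-bound a b X stable = ≤ᵇ⇒≤ _ _ (T-not-∨ checked (all₃-intro λ s → all₃-intro λ t → ≤⇒≤ᵇ (stable s t)))
  where
  p = ∑₃ (ind ∘ a)
  q = ∑₃ (ind ∘ b)
  Y : Fin 3 → Fin 3 → ℕ
  Y s t = ind (X s t)
  a₀ = ⟪ a ⟫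
  b₀ = ⟪ b ⟫
  leaf-at = leaf (φ p + φ q) (9 * (weight p * weight q)) (bound p q) a₀ b₀
  -- The search supplies tables such as `⟪ a ⟫` where the goal has `ind ∘ a`. As `leaf` applies them
  -- to 0F, 1F and 2F only, both sides compute to the same Boolean.
  checked : T (leaf (φ p + φ q) (9 * (weight p * weight q)) (bound p q) (ind ∘ a) (ind ∘ b) Y)
  checked = Equivalence.from T-≡
    (bits₃-elim (λ z → leaf-at ⟨ ⟪ X 0F ⟫ , ⟪ X 1F ⟫ , z ⟩)
    (bits₃-elim (λ y → bits₃ λ z → leaf-at ⟨ ⟪ X 0F ⟫ , y , z ⟩)
    (bits₃-elim (λ x → bits₃ λ y → bits₃ λ z → leaf-at ⟨ x , y , z ⟩)
    (bits₃-elim (λ b′ → check p (∑₃ b′) a₀ b′)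
    (bits₃-elim (λ a′ → bits₃ λ b′ → check (∑₃ a′) (∑₃ b′) a′ b′) check-all a) b) (X 0F)) (X 1F)) (X 2F))

-- Triangles of a labeled complete graph

Corners : ℕ → Set
Corners n = Fin 3 → Fin n

module _ {n : ℕ} (c : Labeling n) where

  -- The summands are ordered as in `plusTriangle`, so that the two agree by computation.
  triangle : Corners n → ℕ
  triangle f = ind (c (f 0F) (f 1F)) + ind (c (f 0F) (f 2F)) + ind (c (f 1F) (f 2F))

  opposite : Corners n → Fin 3 → Bool
  opposite f 0F = c (f 1F) (f 2F)
  opposite f 1F = c (f 0F) (f 2F)
  opposite f 2F = c (f 0F) (f 1F)

  crossEdges : Corners n → Corners n → ℕ
  crossEdges f g = ∑[ s < 3 ] ∑[ t < 3 ] ind (c (f s) (g t))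

  Switchable : Corners n → Corners n → Bool
  Switchable f g = switchable (ind ∘ opposite g) λ s t → ind (c (f s) (g t))

  triangle-opposite : ∀ f → triangle f ≡ ∑₃ (ind ∘ opposite f)
  triangle-opposite f = reverse (ind (c (f 0F) (f 1F))) _ _
    where
    reverse : ∀ x y z → x + y + z ≡ z + y + x
    reverse = solve-∀

  triangle-cong : ∀ {f g} → (∀ s → f s ≡ g s) → triangle f ≡ triangle g
  triangle-cong f≗g rewrite f≗g 0F | f≗g 1F | f≗g 2F = refl

  triangle≤3 : ∀ f → triangle f ≤ 3
  triangle≤3 f = +-mono-≤ (+-mono-≤ (ind≤1 (c (f 0F) (f 1F))) (ind≤1 (c (f 0F) (f 2F)))) (ind≤1 (c (f 1F) (f 2F)))

  crossEdges≤9 : ∀ f g → crossEdges f g ≤ 9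
  crossEdges≤9 f g = ∑-mono {3} {g = λ _ → 3} λ s → ∑-mono {3} {g = λ _ → 1} λ t → ind≤1 (c (f s) (g t))

  -- The replaced position decides on which side of `c` the new vertex stands; hence its labels are
  -- given in both orders.
  triangle-updateAt : ∀ f s v (x : Fin 3 → Bool) → (∀ u → c (f u) v ≡ x u) → (∀ u → c v (f u) ≡ x u) →
    triangle (updateAt f s (const v)) ≡ replaced (ind ∘ opposite f) (ind ∘ x) s
  triangle-updateAt f 0F v x fv vf rewrite vf 1F | vf 2F = rotate (ind (x 1F)) _ _
    where
    rotate : ∀ x y z → x + y + z ≡ z + x + y
    rotate = solve-∀
  triangle-updateAt f 1F v x fv vf rewrite fv 0F | vf 2F = rotate (ind (x 0F)) _ _
    where
    rotate : ∀ x y z → x + y + z ≡ y + z + x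
    rotate = solve-∀
  triangle-updateAt f 2F v x fv vf rewrite fv 0F | fv 1F = refl

  module _ (c-sym : ∀ (i j : Fin n) → c i j ≡ c j i) where

    Switchable-transpose : ∀ f g →
      switchable (ind ∘ opposite f) (λ t s → ind (c (f s) (g t))) ≡ Switchable g f
    Switchable-transpose f g
      -- `switchable` inspects only corners 0 and 1 of the triangle that offers a vertex, here `g`,
      -- so six edges have to be turned round.
      rewrite c-sym (f 0F) (g 0F) | c-sym (f 1F) (g 0F) | c-sym (f 2F) (g 0F)
            | c-sym (f 0F) (g 1F) | c-sym (f 1F) (g 1F) | c-sym (f 2F) (g 1F) = refl

    crossEdges-bound : ∀ f g →
      (∀ s t → φ (triangle (updateAt f s (const (g t)))) + φ (triangle (updateAt g t (const (f s)))) ≤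
               φ (triangle f) + φ (triangle g)) →
      4 * crossEdges f g + 9 * (weight (triangle f) * weight (triangle g)) ≤
      bound (triangle f) (triangle g) + 4 * ind (Switchable f g) + 4 * ind (Switchable g f)
    crossEdges-bound f g stable =
      convert (triangle-opposite f) (triangle-opposite g) cross≡ refl (Switchable-transpose f g) stable′
      where
      X : Fin 3 → Fin 3 → Bool
      X s t = c (f s) (g t)
      ∑₃≡∑ : ∀ (h : Fin 3 → ℕ) → sum h ≡ ∑₃ h
      ∑₃≡∑ h = assoc (h 0F) (h 1F) (h 2F)
        where
        assoc : ∀ x y z → x + (y + (z + 0)) ≡ x + y + z
        assoc = solve-∀
      cross≡ : crossEdges f g ≡ ∑₃ (λ s → ∑₃ λ t → ind (X s t))
      cross≡ = trans (sum-cong-≗ {3} λ s → ∑₃≡∑ (λ t → ind (X s t))) (∑₃≡∑ λ s → ∑₃ λ t → ind (X s t))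
      stable′ : ∀ s t → φ (replaced (ind ∘ opposite f) (λ s′ → ind (X s′ t)) s) +
                        φ (replaced (ind ∘ opposite g) (λ t′ → ind (X s t′)) t) ≤
                        φ (triangle f) + φ (triangle g)
      stable′ s t = subst₂ (λ x y → φ x + φ y ≤ φ (triangle f) + φ (triangle g))
        (triangle-updateAt f s (g t) (λ s′ → X s′ t) (λ _ → refl) (λ u → c-sym (g t) (f u)))
        (triangle-updateAt g t (f s) (X s) (λ u → c-sym (g u) (f s)) (λ _ → refl))
        (stable s t)
      -- With the counts generalised to variables, all differences in form are removed by matching
      -- on `refl`.
      convert : ∀ {p q e r r′} → p ≡ ∑₃ (ind ∘ opposite f) → q ≡ ∑₃ (ind ∘ opposite g) →
        e ≡ ∑₃ (λ s → ∑₃ λ t → ind (X s t)) →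
        switchable (ind ∘ opposite g) (λ s t → ind (X s t)) ≡ r →
        switchable (ind ∘ opposite f) (λ t s → ind (X s t)) ≡ r′ →
        (∀ s t → φ (replaced (ind ∘ opposite f) (λ s′ → ind (X s′ t)) s) +
                 φ (replaced (ind ∘ opposite g) (λ t′ → ind (X s t′)) t) ≤ φ p + φ q) →
        4 * e + 9 * (weight p * weight q) ≤ bound p q + 4 * ind r + 4 * ind r′
      convert refl refl refl refl refl = cross-bound (opposite f) (opposite g) X

    -- A single position `t` of `g` works for corner 0 and for corner 1 of `f`. Of two switchable
    -- partners, one can thus take corner 0 and the other corner 1.
    Switchable-elim : ∀ f g → T (Switchable f g) → triangle g ≡ 1 ×
      ∃ λ t → triangle (updateAt g t (const (f 0F))) ≡ 3 × triangle (updateAt g t (const (f 1F))) ≡ 3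
    Switchable-elim f g h =
      let one , h′ = Equivalence.to (T-∧ {∑₃ (ind ∘ opposite g) ≡ᵇ 1}) h
          t , h″ = any₃-elim (λ t → (new 0F t ≡ᵇ 3) ∧ (new 1F t ≡ᵇ 3)) h′
          three₀ , three₁ = Equivalence.to (T-∧ {new 0F t ≡ᵇ 3}) h″
      in trans (triangle-opposite g) (≡ᵇ⇒≡ _ 1 one)
       , t , trans (update 0F t) (≡ᵇ⇒≡ _ 3 three₀) , trans (update 1F t) (≡ᵇ⇒≡ _ 3 three₁)
      where
      new : Fin 3 → Fin 3 → ℕ
      new s = replaced (ind ∘ opposite g) λ u → ind (c (f s) (g u))
      update : ∀ s t → triangle (updateAt g t (const (f s))) ≡ new s t
      update s t = triangle-updateAt g t (f s) (c (f s) ∘ g) (λ u → c-sym (g u) (f s)) (λ _ → refl)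

-- Exchanging two vertices of a C3-factor

transpose-left : ∀ {n} (i j : Fin n) → transpose i j i ≡ j
transpose-left i j with i ≟ i
... | yes _   = refl
... | no i≢i = contradiction refl i≢i

transpose-right : ∀ {n} (i j : Fin n) → transpose i j j ≡ i
transpose-right i j with j ≟ i
... | yes j≡i = j≡i
... | no _ with j ≟ j
...   | yes _   = refl
...   | no j≢j = contradiction refl j≢j

transpose-other : ∀ {n} {i j k : Fin n} → k ≢ i → k ≢ j → transpose i j k ≡ k
transpose-other {i = i} {j} {k} k≢i k≢j with k ≟ i
... | yes k≡i = contradiction k≡i k≢i
... | no _ with k ≟ j
...   | yes k≡j = contradiction k≡j k≢j
...   | no _   = refl

φ-mono : ∀ {p q} → p ≤ q → φ p ≤ φ q
φ-mono p≤q = +-mono-≤ p≤q (weight-mono p≤q)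
  where
  weight-mono : ∀ {p q} → p ≤ q → weight p ≤ weight q
  weight-mono z≤n = z≤n
  weight-mono (s≤s {n = zero} z≤n) = s≤s z≤n
  weight-mono (s≤s {n = suc _} z≤n) = s≤s z≤n
  weight-mono (s≤s (s≤s _)) = ≤-refl

corners : ∀ {m n} → C3Factor m n → Fin m → Corners n
corners F k t = Bijection.to F (k , t)

exchange : ∀ {m n} → Fin n → Fin n → C3Factor m n → C3Factor m n
exchange x y F = ↔⇒⤖ (Perm.transpose x y) ⤖-∘ F

corners-≡ : ∀ {m n} (F : C3Factor m n) {k l s t} → corners F k s ≡ corners F l t → (k , s) ≡ (l , t)
corners-≡ F = Bijection.injective F

-- Both sides are moved so that no truncated subtraction occurs.
∑-change₂ : ∀ {m} (f g : Fin m → ℕ) {k l} → k ≢ l → (∀ i → i ≢ k → i ≢ l → f i ≡ g i) →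
            sum f + (g k + g l) ≡ sum g + (f k + f l)
∑-change₂ f g {k} {l} k≢l unchanged =
  trans (sym (expand f g)) (trans (sum-cong-≗ pointwise) (expand g f))
  where
  expand : ∀ f g → ∑[ i < _ ] (f i + (single k (g k) i + single l (g l) i)) ≡ sum f + (g k + g l)
  expand f g = trans (∑-distrib-+ f _) (cong (sum f +_) (trans (∑-distrib-+ (single k (g k)) (single l (g l)))
    (cong₂ _+_ (∑-single k (g k)) (∑-single l (g l)))))
  pointwise : ∀ i → f i + (single k (g k) i + single l (g l) i) ≡ g i + (single k (f k) i + single l (f l) i)
  pointwise i with k ≟ i | l ≟ i
  ... | yes refl | yes refl = contradiction refl k≢l
  ... | yes refl | no _     = trans (cong (f k +_) (+-identityʳ (g k)))
                              (trans (+-comm (f k) (g k)) (cong (g k +_) (sym (+-identityʳ (f k)))))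
  ... | no _     | yes refl = +-comm (f l) (g l)
  ... | no k≢i   | no l≢i   = cong (_+ 0) (unchanged i (k≢i ∘ sym) (l≢i ∘ sym))

-- The potential and locally optimal factors

module _ {m n : ℕ} (c : Labeling n) where

  potential : C3Factor m n → ℕ
  potential F = ∑[ k < m ] φ (triangle c (corners F k))

  potential≤5m : ∀ F → potential F ≤ m * 5
  potential≤5m F = ≤-trans (∑-mono λ k → φ-mono (triangle≤3 c (corners F k))) (≤-reflexive (∑-const m 5))

  module _ (F : C3Factor m n) {k l : Fin m} (k≢l : k ≢ l) (s t : Fin 3) where

    private
      F′ = exchange (corners F k s) (corners F l t) F

    corners-exchange-left : ∀ u → corners F′ k u ≡ updateAt (corners F k) s (const (corners F l t)) u
    corners-exchange-left u with u ≟ s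
    ... | yes refl = trans (transpose-left (corners F k s) _) (sym (updateAt-updates s (corners F k)))
    ... | no u≢s = trans (transpose-other (u≢s ∘ cong proj₂ ∘ corners-≡ F) (k≢l ∘ cong proj₁ ∘ corners-≡ F))
                         (sym (updateAt-minimal u s (corners F k) u≢s))

    corners-exchange-right : ∀ u → corners F′ l u ≡ updateAt (corners F l) t (const (corners F k s)) u
    corners-exchange-right u with u ≟ t
    ... | yes refl = trans (transpose-right _ (corners F l t)) (sym (updateAt-updates t (corners F l)))
    ... | no u≢t = trans (transpose-other (k≢l ∘ sym ∘ cong proj₁ ∘ corners-≡ F) (u≢t ∘ cong proj₂ ∘ corners-≡ F))
                         (sym (updateAt-minimal u t (corners F l) u≢t))

    corners-exchange-other : ∀ {i} → i ≢ k → i ≢ l → ∀ u → corners F′ i u ≡ corners F i u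
    corners-exchange-other i≢k i≢l u =
      transpose-other (i≢k ∘ cong proj₁ ∘ corners-≡ F) (i≢l ∘ cong proj₁ ∘ corners-≡ F)

    potential-exchange :
      potential F′ + (φ (triangle c (corners F k)) + φ (triangle c (corners F l))) ≡
      potential F + (φ (triangle c (corners F′ k)) + φ (triangle c (corners F′ l)))
    potential-exchange = ∑-change₂ (λ i → φ (triangle c (corners F′ i))) (λ i → φ (triangle c (corners F i))) k≢l
      λ i i≢k i≢l → cong φ (triangle-cong c (corners-exchange-other i≢k i≢l))

  -- Single exchanges yield the bound on the edges between two triangles, double exchanges the
  -- uniqueness of switchable partners.
  record LocallyOptimal (F : C3Factor m n) : Set where
    field
      optimal₁ : ∀ x y → potential (exchange x y F) ≤ potential F
      optimal₂ : ∀ x y z w → potential (exchange z w (exchange x y F)) ≤ potential F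

  spend : ∀ {a b d fuel} → d ≤ a + suc fuel → a < b → d ≤ b + fuel
  spend {a} {fuel = fuel} d≤ a<b = ≤-trans d≤ (≤-trans (≤-reflexive (+-suc a fuel)) (+-monoˡ-≤ fuel a<b))

  -- Each improvement raises the potential by at least 1, and the potential never exceeds 5 (the
  -- value `φ 3`) per triangle. The fuel bounds the distance to this cap, hence the number of
  -- improvements left.
  climb : ∀ fuel F → m * 5 ≤ potential F + fuel → ∃ LocallyOptimal
  -- Without fuel the cap is attained, so that no factor at all is better.
  climb zero F top = F , record { optimal₁ = λ x y → max (exchange x y F)
                                ; optimal₂ = λ x y z w → max (exchange z w (exchange x y F)) }
    where
    max : ∀ F′ → potential F′ ≤ potential F
    max F′ = ≤-trans (potential≤5m F′) (≤-trans top (≤-reflexive (+-identityʳ _)))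
  climb (suc fuel) F below
    with any? (λ x → any? λ y → potential F <? potential (exchange x y F))
       | any? (λ x → any? λ y → any? λ z → any? λ w → potential F <? potential (exchange z w (exchange x y F)))
  ... | yes (x , y , better) | _ = climb fuel (exchange x y F) (spend below better)
  ... | no _ | yes (x , y , z , w , better) = climb fuel (exchange z w (exchange x y F)) (spend below better)
  ... | no none₁ | no none₂ = F , record
    { optimal₁ = λ x y → ≮⇒≥ λ better → none₁ (x , y , better)
    ; optimal₂ = λ x y z w → ≮⇒≥ λ better → none₂ (x , y , z , w , better) }

  module _ (c-sym : ∀ (i j : Fin n) → c i j ≡ c j i) {F : C3Factor m n} (optimal : LocallyOptimal F) where
    open LocallyOptimal optimal

    private
      p : Fin m → ℕ
      p k = triangle c (corners F k)

    -- An exchange affects only the two triangles concerned, so cancelling the potential of `F`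
    -- leaves a comparison of four values of `φ`.
    exchange-stable : ∀ {k l} → k ≢ l → ∀ s t →
      φ (triangle c (updateAt (corners F k) s (const (corners F l t)))) +
      φ (triangle c (updateAt (corners F l) t (const (corners F k s)))) ≤ φ (p k) + φ (p l)
    exchange-stable {k} {l} k≢l s t = subst₂ (λ x y → φ x + φ y ≤ φ (p k) + φ (p l))
      (triangle-cong c (corners-exchange-left F k≢l s t)) (triangle-cong c (corners-exchange-right F k≢l s t))
      (+-cancelˡ-≤ (potential F) _ _ (≤-trans (≤-reflexive (sym (potential-exchange F k≢l s t)))
        (+-monoˡ-≤ _ (optimal₁ (corners F k s) (corners F l t)))))

    -- If two triangles were switchable with respect to k, both could be completed at the expense of
    -- k, for a potential of at least 5 + 5 instead of at most 5 + 2 + 2.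
    Switchable-unique : ∀ {k l l′} → k ≢ l → k ≢ l′ →
      T (Switchable c (corners F k) (corners F l)) → T (Switchable c (corners F k) (corners F l′)) → l ≡ l′
    Switchable-unique {k} {l} {l′} k≢l k≢l′ r r′ with l ≟ l′
    ... | yes l≡l′ = l≡l′
    ... | no l≢l′ with Switchable-elim c c-sym (corners F k) (corners F l) r
                     | Switchable-elim c c-sym (corners F k) (corners F l′) r′
    ...   | one , t , three , _ | one′ , t′ , _ , three′ = contradiction gain (≤⇒≯ (optimal₂ _ _ _ _))
      where
      F₁ = exchange (corners F k 0F) (corners F l t) F
      F₂ = exchange (corners F₁ k 1F) (corners F₁ l′ t′) F₁
      p₁ p₂ : Fin m → ℕ
      p₁ i = triangle c (corners F₁ i)
      p₂ i = triangle c (corners F₂ i)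
      -- The first exchange leaves the triangle `l′` and corner 1 of `k` in place, so the second can
      -- still complete `l′`.
      kept₁ : ∀ u → corners F₁ l′ u ≡ corners F l′ u
      kept₁ = corners-exchange-other F k≢l 0F t (k≢l′ ∘ sym) (l≢l′ ∘ sym)
      kept₂ : corners F₁ k 1F ≡ corners F k 1F
      kept₂ = corners-exchange-left F k≢l 0F t 1F
      p₁l : p₁ l ≡ 3
      p₁l = trans (triangle-cong c (corners-exchange-right F k≢l 0F t)) three
      p₁l′ : p₁ l′ ≡ 1
      p₁l′ = trans (triangle-cong c kept₁) one′
      p₂l′ : p₂ l′ ≡ 3
      p₂l′ = trans (triangle-cong c λ u → trans (corners-exchange-right F₁ k≢l′ 1F t′ u) (updateAt-cong u)) three′
        where
        updateAt-cong : ∀ u → updateAt (corners F₁ l′) t′ (const (corners F₁ k 1F)) u ≡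
                              updateAt (corners F l′) t′ (const (corners F k 1F)) u
        updateAt-cong u with u ≟ t′
        ... | yes refl = trans (updateAt-updates t′ (corners F₁ l′))
                         (trans kept₂ (sym (updateAt-updates t′ (corners F l′))))
        ... | no u≢t′ = trans (updateAt-minimal u t′ (corners F₁ l′) u≢t′)
                        (trans (kept₁ u) (sym (updateAt-minimal u t′ (corners F l′) u≢t′)))
      gain : potential F < potential F₂
      gain = balance (potential F) (potential F₁) (potential F₂) (φ (p k)) (φ (p₁ k)) (φ (p₂ k))
        (φ-mono (triangle≤3 c (corners F k)))
        (subst₂ (λ x y → potential F₁ + (φ (p k) + φ x) ≡ potential F + (φ (p₁ k) + φ y)) one p₁l
          (potential-exchange F k≢l 0F t))
        (subst₂ (λ x y → potential F₂ + (φ (p₁ k) + φ x) ≡ potential F₁ + (φ (p₂ k) + φ y)) p₁l′ p₂l′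
          (potential-exchange F₁ k≢l′ 1F t′))
        where
        balance : ∀ P P₁ P₂ a a₁ a₂ → a ≤ 5 → P₁ + (a + 2) ≡ P + (a₁ + 5) → P₂ + (a₁ + 2) ≡ P₁ + (a₂ + 5) → P < P₂
        -- The two equations add up to P₂ + a = P + a₂ + 6, where a ≤ 5 and a₂ ≥ 0. The summand 9 +
        -- a₁ pads both sides so that nothing is subtracted.
        balance P P₁ P₂ a a₁ a₂ a≤5 e₁ e₂ = +-cancelʳ-≤ (9 + a₁) _ _ (begin
          suc P + (9 + a₁)          ≡⟨ rearrange₁ P a₁ ⟩
          P + (a₁ + 5) + 5          ≡⟨ cong (_+ 5) e₁ ⟨
          P₁ + (a + 2) + 5          ≤⟨ m≤m+n _ a₂ ⟩
          P₁ + (a + 2) + 5 + a₂     ≡⟨ rearrange₂ P₁ a a₂ ⟩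
          P₁ + (a₂ + 5) + (a + 2)   ≡⟨ cong (_+ (a + 2)) e₂ ⟨
          P₂ + (a₁ + 2) + (a + 2)   ≤⟨ +-monoʳ-≤ (P₂ + (a₁ + 2)) (+-monoˡ-≤ 2 a≤5) ⟩
          P₂ + (a₁ + 2) + 7         ≡⟨ rearrange₃ P₂ a₁ ⟩
          P₂ + (9 + a₁)             ∎)
          where
          open ≤-Reasoning
          rearrange₁ : ∀ P a → suc P + (9 + a) ≡ P + (a + 5) + 5
          rearrange₁ = solve-∀
          rearrange₂ : ∀ P a b → P + (a + 2) + 5 + b ≡ P + (b + 5) + (a + 2)
          rearrange₂ = solve-∀
          rearrange₃ : ∀ P a → P + (a + 2) + 7 ≡ P + (9 + a)
          rearrange₃ = solve-∀

-- Counting plus-edges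

module _ {n : ℕ} (c : Labeling n) where

  plusEntries : ℕ
  plusEntries = ∑[ i < n ] ∑[ j < n ] ind (c i j)

  edgeCount-∑ : ∀ b → edgeCount c b ≡ ∑[ i < n ] ∑[ j < n ] ind (isYes (i Fin.<? j) ∧ isYes (c i j Bool.≟ b))
  edgeCount-∑ b = trans (sum-allFin λ i → List.sum (map (entry i) (allFin n))) (sum-cong-≗ λ i → sum-allFin (entry i))
    where
    entry : Fin n → Fin n → ℕ
    entry i j = ind (isYes (i Fin.<? j) ∧ isYes (c i j Bool.≟ b))

  -- Exactly half of the n² - n ordered pairs off the diagonal carry a plus. The diagonal values of
  -- `c` are arbitrary and can only add to `plusEntries`, whence an inequality.
  balanced⇒many-plusEntries : (∀ i j → c i j ≡ c j i) → Balanced c → n * n ≤ 2 * plusEntries + n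
  balanced⇒many-plusEntries c-sym balanced = begin
    n * n                                                       ≡⟨ cong (n *_) (sym (*-identityʳ n)) ⟩
    n * (n * 1)                                                 ≡⟨ ∑-const n (n * 1) ⟨
    ∑[ i < n ] (n * 1)                                          ≡⟨ sum-cong-≗ {n} (λ i → ∑-const n 1) ⟨
    ∑[ i < n ] ∑[ j < n ] 1                                     ≤⟨ ∑-mono {n} (λ i → ∑-mono (trichotomy i)) ⟩
    ∑[ i < n ] ∑[ j < n ] (less i j + less j i + single i 1 j)  ≡⟨ ∑∑-distrib-+ (λ i j → less i j + less j i) (λ i → single i 1) ⟩
    ∑[ i < n ] ∑[ j < n ] (less i j + less j i) + ∑[ i < n ] ∑[ j < n ] single i 1 j
      ≡⟨ cong₂ _+_ (∑∑-symmetrise less)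
                   (trans (sum-cong-≗ {n} λ i → ∑-single i 1) (trans (∑-const n 1) (*-identityʳ n))) ⟩
    2 * ∑[ i < n ] ∑[ j < n ] less i j + n                      ≡⟨ cong (λ x → 2 * x + n) all-edges ⟩
    2 * (2 * plus) + n                                          ≤⟨ +-monoˡ-≤ n (*-monoʳ-≤ 2 twice-plus) ⟩
    2 * plusEntries + n                                         ∎
    where
    open ≤-Reasoning
    less : Fin n → Fin n → ℕ
    less i j = ind (isYes (i Fin.<? j))
    edge : Bool → Fin n → Fin n → ℕ
    edge b i j = ind (isYes (i Fin.<? j) ∧ isYes (c i j Bool.≟ b))
    plus = ∑[ i < n ] ∑[ j < n ] edge true i j

    ∑∑-symmetrise : ∀ (f : Fin n → Fin n → ℕ) →
      ∑[ i < n ] ∑[ j < n ] (f i j + f j i) ≡ 2 * ∑[ i < n ] ∑[ j < n ] f i j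
    ∑∑-symmetrise f = trans (∑∑-distrib-+ f λ i j → f j i)
      (cong (sum (sum ∘ f) +_) (trans (∑-comm λ i j → f j i) (sym (+-identityʳ _))))

    trichotomy : ∀ i j → 1 ≤ less i j + less j i + single i 1 j
    trichotomy i j with i ≟ j | i Fin.<? j | j Fin.<? i
    ... | yes _   | x | y             = m≤n+m 1 (ind (isYes x) + ind (isYes y))
    ... | no _    | yes _   | _       = s≤s z≤n
    ... | no _    | no _    | yes _   = s≤s z≤n
    ... | no i≢j | no i≮j | no j≮i = contradiction (Finₚ.toℕ-injective (≤-antisym (≮⇒≥ j≮i) (≮⇒≥ i≮j))) i≢j

    split : ∀ x y → ind (x ∧ isYes (y Bool.≟ true)) + ind (x ∧ isYes (y Bool.≟ false)) ≡ ind x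
    split false y     = refl
    split true  true  = refl
    split true  false = refl

    all-edges : ∑[ i < n ] ∑[ j < n ] less i j ≡ 2 * plus
    all-edges = begin-equality
      ∑[ i < n ] ∑[ j < n ] less i j
        ≡⟨ sum-cong-≗ (λ i → sum-cong-≗ λ j → split (isYes (i Fin.<? j)) (c i j)) ⟨
      ∑[ i < n ] ∑[ j < n ] (edge true i j + edge false i j)
        ≡⟨ ∑∑-distrib-+ (edge true) (edge false) ⟩
      plus + ∑[ i < n ] ∑[ j < n ] edge false i j
        ≡⟨ cong (plus +_) (trans (sym (edgeCount-∑ false)) (trans (sym balanced) (trans (edgeCount-∑ true) (sym (+-identityʳ plus))))) ⟩
      2 * plus ∎

    both : ∀ i j → edge true i j + edge true j i ≤ ind (c i j)
    both i j rewrite c-sym j i with c i j | i Fin.<? j | j Fin.<? i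
    ... | _     | yes i<j | yes j<i = contradiction j<i (<-asym i<j)
    ... | false | yes _   | no _    = z≤n
    ... | false | no _    | yes _   = z≤n
    ... | false | no _    | no _    = z≤n
    ... | true  | yes _   | no _    = ≤-refl
    ... | true  | no _    | yes _   = ≤-refl
    ... | true  | no _    | no _    = z≤n

    twice-plus : 2 * plus ≤ plusEntries
    twice-plus = ≤-trans (≤-reflexive (sym (∑∑-symmetrise (edge true)))) (∑-mono λ i → ∑-mono (both i))

∑-corners : ∀ {m n} (F : C3Factor m n) (h : Fin n → ℕ) → sum h ≡ ∑[ k < m ] ∑[ s < 3 ] h (corners F k s)
∑-corners {m} {n} F h = trans (sum-permute h π) (trans (∑-combine m (h ∘ Bijection.to F ∘ remQuot {m} 3))
  (sum-cong-≗ λ k → sum-cong-≗ λ s → cong (h ∘ Bijection.to F) (Finₚ.remQuot-combine k s)))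
  where
  π : Permutation (m * 3) n
  π = ⤖⇒↔ F ↔-∘ *↔× {m} {3}

plusEntries-crossEdges : ∀ {m n} (c : Labeling n) (F : C3Factor m n) →
  plusEntries c ≡ ∑[ k < m ] ∑[ l < m ] crossEdges c (corners F k) (corners F l)
plusEntries-crossEdges {m} {n} c F =
  trans (∑-corners F λ i → ∑[ j < n ] ind (c i j)) (sum-cong-≗ λ k →
    trans (sum-cong-≗ λ s → ∑-corners F λ j → ind (c (corners F k s) j))
          (∑-comm λ s l → ∑[ t < 3 ] ind (c (corners F k s) (corners F l t))))

-- Summation over all ordered pairs of triangles

module _ {m n : ℕ} (c : Labeling n) (c-sym : ∀ (i j : Fin n) → c i j ≡ c j i)
         {F : C3Factor m n} (optimal : LocallyOptimal c F) where

  private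
    p w : Fin m → ℕ
    p k = triangle c (corners F k)
    w k = weight (p k)
    P = sum p
    W = sum w

    e : Fin m → Fin m → ℕ
    e k l = crossEdges c (corners F k) (corners F l)

    -- The diagonal is cut out because `Switchable-unique` speaks of partners distinct from `k`.
    r : Fin m → Fin m → Bool
    r k l = not (does (k ≟ l)) ∧ Switchable c (corners F k) (corners F l)

    r-row : ∀ k → ∑[ l < m ] ind (r k l) ≤ 1
    r-row k = ∑-indicator-≤1 (r k) unique
      where
      unique : ∀ l l′ → T (r k l) → T (r k l′) → l ≡ l′
      unique l l′ h h′ with k ≟ l | k ≟ l′
      ... | no k≢l | no k≢l′ = Switchable-unique c c-sym optimal k≢l k≢l′ h h′

    ∑∑-r : ∑[ k < m ] ∑[ l < m ] ind (r k l) ≤ m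
    ∑∑-r = ≤-trans (∑-mono r-row) (≤-reflexive (trans (∑-const m 1) (*-identityʳ m)))

    diagonal-weight : ∀ x → 9 * (weight x * weight x) ≤ bound x x
    diagonal-weight 0 = z≤n
    diagonal-weight 1 = ≤ᵇ⇒≤ 9 20 tt
    diagonal-weight (suc (suc x)) = ≤-trans (m≤m+n 36 (20 + 16 * x)) (≤-reflexive (expand x))
      where
      expand : ∀ x → 36 + (20 + 16 * x) ≡ 4 * ((2 + x) * 2) + 4 * ((2 + x) * 2) + 6 * 2 + 6 * 2
      expand = solve-∀

    -- Off the diagonal this is local optimality. For `k` equal to `l` the at most nine entries
    -- counted by `e k k` are paid for by 36 = 4 * 9, and `diagonal-weight` covers the rest.
    pairwise : ∀ k l → 4 * e k l + 9 * (w k * w l) ≤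
      bound (p k) (p l) + 4 * ind (r k l) + 4 * ind (r l k) + single k 36 l
    pairwise k l with k ≟ l | l ≟ k
    ... | no k≢l   | yes l≡k = contradiction (sym l≡k) k≢l
    ... | no k≢l   | no _    = ≤-trans
      (crossEdges-bound c c-sym (corners F k) (corners F l) (exchange-stable c c-sym optimal k≢l))
      (≤-reflexive (sym (+-identityʳ _)))
    ... | yes refl | no k≢k  = contradiction refl k≢k
    ... | yes refl | yes _   = begin
      4 * e k k + 9 * (w k * w k)        ≤⟨ +-mono-≤ (*-monoʳ-≤ 4 (crossEdges≤9 c (corners F k) (corners F k))) (diagonal-weight (p k)) ⟩
      36 + bound (p k) (p k)             ≡⟨ rearrange (bound (p k) (p k)) ⟩
      bound (p k) (p k) + 0 + 0 + 36     ∎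
      where
      open ≤-Reasoning
      rearrange : ∀ x → 36 + x ≡ x + 0 + 0 + 36
      rearrange = solve-∀

    ∑∑ : (Fin m → Fin m → ℕ) → ℕ
    ∑∑ f = ∑[ k < m ] ∑[ l < m ] f k l

    infixl 6 _⊕_
    -- With `_⊛_`, this lets the bound on a double sum be written in the shape of its summand, one
    -- line per term.
    _⊕_ : ∀ {f g a b} → ∑∑ f ≤ a → ∑∑ g ≤ b → ∑∑ (λ k l → f k l + g k l) ≤ a + b
    _⊕_ {f} {g} f≤a g≤b = ≤-trans (≤-reflexive (∑∑-distrib-+ f g)) (+-mono-≤ f≤a g≤b)

    infixr 7 _⊛_
    _⊛_ : ∀ x {f a} → ∑∑ f ≤ a → ∑∑ (λ k l → x * f k l) ≤ x * a
    _⊛_ x {f} f≤a = ≤-trans (≤-reflexive (∑∑-*ˡ x f)) (*-monoʳ-≤ x f≤a)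

  crossEdges-total : 4 * plusEntries c + 9 * (W * W) ≤
    4 * (P * W) + 4 * (W * P) + 6 * (m * W) + 6 * (m * W) + 4 * m + 4 * m + m * 36
  crossEdges-total = begin
    4 * plusEntries c + 9 * (W * W)
      ≡⟨ cong₂ _+_ (trans (cong (4 *_) (plusEntries-crossEdges c F)) (sym (∑∑-*ˡ 4 e)))
                   (trans (cong (9 *_) (sym (∑∑-product w w))) (sym (∑∑-*ˡ 9 λ k l → w k * w l))) ⟩
    ∑∑ (λ k l → 4 * e k l) + ∑∑ (λ k l → 9 * (w k * w l))
      ≡⟨ ∑∑-distrib-+ (λ k l → 4 * e k l) (λ k l → 9 * (w k * w l)) ⟨
    ∑∑ (λ k l → 4 * e k l + 9 * (w k * w l))
      ≤⟨ ∑-mono {m} (λ k → ∑-mono {m} (pairwise k)) ⟩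
    ∑∑ (λ k l → 4 * (p k * w l) + 4 * (p l * w k) + 6 * w k + 6 * w l +
                4 * ind (r k l) + 4 * ind (r l k) + single k 36 l)
      ≤⟨ 4 ⊛ ≤-reflexive (∑∑-product p w)
       ⊕ 4 ⊛ ≤-reflexive (trans (sum-cong-≗ {m} λ k → sum-cong-≗ {m} λ l → *-comm (p l) (w k)) (∑∑-product w p))
       ⊕ 6 ⊛ ≤-reflexive (trans (∑-comm {m} {m} λ k l → w k) (∑-const m W))
       ⊕ 6 ⊛ ≤-reflexive (∑-const m W)
       ⊕ 4 ⊛ ∑∑-r
       ⊕ 4 ⊛ ≤-trans (≤-reflexive (∑-comm {m} {m} λ k l → ind (r l k))) ∑∑-r
       ⊕ ≤-reflexive (trans (sum-cong-≗ {m} λ k → ∑-single k 36) (∑-const m 36)) ⟩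
    4 * (P * W) + 4 * (W * P) + 6 * (m * W) + 6 * (m * W) + 4 * m + 4 * m + m * 36 ∎
    where open ≤-Reasoning

-- The final estimate by AM-GM

-- The difference of the two sides is the square of the distance `d` of the numbers; ordering them
-- avoids subtraction.
4ab≤[a+b]² : ∀ a b → 4 * (a * b) ≤ (a + b) * (a + b)
4ab≤[a+b]² a b with ≤-total a b
... | inj₁ a≤b with d , refl ← m≤n⇒∃[o]m+o≡n a≤b = ≤-trans (m≤m+n _ (d * d)) (≤-reflexive (expand a d))
  where
  expand : ∀ a d → 4 * (a * (a + d)) + d * d ≡ (a + (a + d)) * (a + (a + d))
  expand = solve-∀
... | inj₂ b≤a with d , refl ← m≤n⇒∃[o]m+o≡n b≤a = ≤-trans (m≤m+n _ (d * d)) (≤-reflexive (expand b d))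
  where
  expand : ∀ b d → 4 * ((b + d) * b) + d * d ≡ (b + d + b) * (b + d + b)
  expand = solve-∀

-- By AM-GM, 18 m² + 9 W² ≥ 18√2 m W, so that dividing by W leaves 8 (P + 30) + 12 m ≥ 18√2 m. The error
-- term 50 m is absorbed by 240 W, as P ≤ 3 m makes W at least about m / 2.
final-estimate : ∀ m P W → 1 ≤ m → P ≤ 3 * m →
  18 * (m * m) + 9 * (W * W) ≤ 8 * (P * W) + 12 * (m * W) + 50 * m →
  18 * ((3 * m) * (3 * m)) ≤ (4 * (P + 30) + 2 * (3 * m)) * (4 * (P + 30) + 2 * (3 * m))
-- For `W` zero the hypothesis says 18 m ≤ 50, so m ≤ 2, and the error term 30 alone outweighs the
-- left-hand side.
final-estimate m@(suc _) P zero _ _ h = begin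
  18 * ((3 * m) * (3 * m))   ≤⟨ *-monoʳ-≤ 18 (*-mono-≤ (*-monoʳ-≤ 3 m≤2) (*-monoʳ-≤ 3 m≤2)) ⟩
  648                        ≤⟨ ≤ᵇ⇒≤ 648 14400 tt ⟩
  120 * 120                  ≤⟨ *-mono-≤ 120≤V 120≤V ⟩
  V * V                      ∎
  where
  open ≤-Reasoning
  V = 4 * (P + 30) + 2 * (3 * m)
  120≤V : 120 ≤ V
  120≤V = ≤-trans (*-monoʳ-≤ 4 (m≤n+m 30 P)) (m≤m+n (4 * (P + 30)) (2 * (3 * m)))
  18m≤50 : 18 * m ≤ 50
  18m≤50 = *-cancelʳ-≤ (18 * m) 50 m (begin
    18 * m * m                            ≡⟨ lhs m ⟩
    18 * (m * m) + 9 * (0 * 0)            ≤⟨ h ⟩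
    8 * (P * 0) + 12 * (m * 0) + 50 * m   ≡⟨ rhs P m ⟩
    50 * m                                ∎)
    where
    lhs : ∀ m → 18 * m * m ≡ 18 * (m * m) + 9 * (0 * 0)
    lhs = solve-∀
    rhs : ∀ P m → 8 * (P * 0) + 12 * (m * 0) + 50 * m ≡ 50 * m
    rhs = solve-∀
  m≤2 : m ≤ 2
  m≤2 = ≮⇒≥ λ 3≤m → <⇒≱ (≤ᵇ⇒≤ 51 54 tt) (≤-trans (*-monoʳ-≤ 18 3≤m) 18m≤50)
-- Multiplied by 4 W², the left-hand side becomes four times the product of 18 m² and 9 W², ready
-- for AM-GM.
final-estimate m@(suc _) P W@(suc _) _ P≤3m h = *-cancelʳ-≤ (18 * ((3 * m) * (3 * m))) (V * V) (4 * (W * W)) (begin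
  18 * ((3 * m) * (3 * m)) * (4 * (W * W))                            ≡⟨ lhs m W ⟩
  4 * (18 * (m * m) * (9 * (W * W)))                                  ≤⟨ 4ab≤[a+b]² (18 * (m * m)) (9 * (W * W)) ⟩
  (18 * (m * m) + 9 * (W * W)) * (18 * (m * m) + 9 * (W * W))         ≤⟨ *-mono-≤ ≤VW ≤VW ⟩
  (2 * V * W) * (2 * V * W)                                           ≡⟨ rhs V W ⟩
  V * V * (4 * (W * W))                                               ∎)
  where
  open ≤-Reasoning
  V = 4 * (P + 30) + 2 * (3 * m)
  lhs : ∀ m W → 18 * ((3 * m) * (3 * m)) * (4 * (W * W)) ≡ 4 * (18 * (m * m) * (9 * (W * W)))
  lhs = solve-∀
  rhs : ∀ V W → (2 * V * W) * (2 * V * W) ≡ V * V * (4 * (W * W))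
  rhs = solve-∀
  18m≤36W+50 : 18 * m ≤ 36 * W + 50
  18m≤36W+50 = *-cancelʳ-≤ (18 * m) (36 * W + 50) m (begin
    18 * m * m                                   ≡⟨ *-assoc 18 m m ⟩
    18 * (m * m)                                 ≤⟨ m≤m+n _ (9 * (W * W)) ⟩
    18 * (m * m) + 9 * (W * W)                   ≤⟨ h ⟩
    8 * (P * W) + 12 * (m * W) + 50 * m          ≤⟨ +-monoˡ-≤ (50 * m) (+-monoˡ-≤ (12 * (m * W)) (*-monoʳ-≤ 8 (*-monoˡ-≤ W P≤3m))) ⟩
    8 * (3 * m * W) + 12 * (m * W) + 50 * m      ≡⟨ collect m W ⟩
    (36 * W + 50) * m                            ∎)
    where
    collect : ∀ m W → 8 * (3 * m * W) + 12 * (m * W) + 50 * m ≡ (36 * W + 50) * m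
    collect = solve-∀
  50m≤240W : 50 * m ≤ 240 * W
  50m≤240W = *-cancelˡ-≤ 18 (begin
    18 * (50 * m)              ≡⟨ swap-factors m ⟩
    50 * (18 * m)              ≤⟨ *-monoʳ-≤ 50 18m≤36W+50 ⟩
    -- Here 1 ≤ W replaces 50 by 50 W; then 50 * 86 = 4300 is just below 18 * 240 = 4320.
    50 * (36 * W + 50)         ≤⟨ *-monoʳ-≤ 50 (+-monoʳ-≤ (36 * W) (*-monoʳ-≤ 50 {1} {W} (s≤s z≤n))) ⟩
    50 * (36 * W + 50 * W)     ≤⟨ m≤m+n _ (20 * W) ⟩
    50 * (36 * W + 50 * W) + 20 * W   ≡⟨ collect W ⟩
    18 * (240 * W)             ∎)
    where
    swap-factors : ∀ m → 18 * (50 * m) ≡ 50 * (18 * m)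
    swap-factors = solve-∀
    collect : ∀ W → 50 * (36 * W + 50 * W) + 20 * W ≡ 18 * (240 * W)
    collect = solve-∀
  ≤VW : 18 * (m * m) + 9 * (W * W) ≤ 2 * V * W
  ≤VW = begin
    18 * (m * m) + 9 * (W * W)                   ≤⟨ h ⟩
    -- The factor 240 = 8 * 30 is the share of the error term 30 in `2 * V`.
    8 * (P * W) + 12 * (m * W) + 50 * m          ≤⟨ +-monoʳ-≤ (8 * (P * W) + 12 * (m * W)) 50m≤240W ⟩
    8 * (P * W) + 12 * (m * W) + 240 * W         ≡⟨ collect m P W ⟩
    2 * V * W                                    ∎
    where
    collect : ∀ m P W → 8 * (P * W) + 12 * (m * W) + 240 * W ≡ 2 * (4 * (P + 30) + 2 * (3 * m)) * W
    collect = solve-∀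

initialFactor : ∀ m → C3Factor m (3 * m)
initialFactor m = ↔⇒⤖ (↔-sym *↔× ↔-∘ ×-comm (Fin m) (Fin 3))

-- For n = 3m and M plus-edges in `F`, the claim is 3√2 n ≤ 4 (M + g(n)) + 2 n, squared to stay
-- within ℕ. Little-o is expressed by (k + 1) g(n) ≤ n for every k and all large n.
theorem2 : Σ (ℕ → ℕ) λ g →
    ((k : ℕ) → ∃ λ N → (n : ℕ) → N ≤ n → suc k * g n ≤ n) ×
    ((m : ℕ) → 1 ≤ m → (c : Labeling (3 * m)) →
    ((i j : Fin (3 * m)) → c i j ≡ c j i) →
    Balanced c →
    ∃ λ (F : C3Factor m (3 * m)) →
    18 * ((3 * m) * (3 * m)) ≤
    (4 * (plusEdges c F + g (3 * m)) + 2 * (3 * m)) *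
    (4 * (plusEdges c F + g (3 * m)) + 2 * (3 * m)))
theorem2 = const 30 , (λ k → suc k * 30 , λ n N≤n → N≤n) , λ m 1≤m c c-sym balanced →
  let F , optimal = climb c (m * 5) (initialFactor m) (m≤n+m (m * 5) (potential c (initialFactor m)))
      P = ∑[ k < m ] triangle c (corners F k)
      P≤3m = ≤-trans (∑-mono λ k → triangle≤3 c (corners F k)) (≤-reflexive (trans (∑-const m 3) (*-comm m 3)))
  in F , subst (λ P → 18 * ((3 * m) * (3 * m)) ≤ (4 * (P + 30) + 2 * (3 * m)) * (4 * (P + 30) + 2 * (3 * m)))
           (sym (sum-allFin (plusTriangle c F)))
           (final-estimate m P (∑[ k < m ] weight (triangle c (corners F k))) 1≤m P≤3m
             (combine-bounds m P _ (plusEntries c) (balanced⇒many-plusEntries c c-sym balanced)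
               (crossEdges-total c c-sym optimal)))
  where
  combine-bounds : ∀ m P W Q → 3 * m * (3 * m) ≤ 2 * Q + 3 * m →
    4 * Q + 9 * (W * W) ≤ 4 * (P * W) + 4 * (W * P) + 6 * (m * W) + 6 * (m * W) + 4 * m + 4 * m + m * 36 →
    18 * (m * m) + 9 * (W * W) ≤ 8 * (P * W) + 12 * (m * W) + 50 * m
  combine-bounds m P W Q dense total = begin
    18 * (m * m) + 9 * (W * W)                ≡⟨ lhs m W ⟩
    2 * (3 * m * (3 * m)) + 9 * (W * W)       ≤⟨ +-monoˡ-≤ (9 * (W * W)) (*-monoʳ-≤ 2 dense) ⟩
    2 * (2 * Q + 3 * m) + 9 * (W * W)         ≡⟨ mid m W Q ⟩
    4 * Q + 9 * (W * W) + 6 * m               ≤⟨ +-monoˡ-≤ (6 * m) total ⟩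
    -- The coefficient 50 = 4 + 4 + 36 + 6 collects switchable pairs in both orders, the diagonal of
    -- triangle pairs and the diagonal of vertex pairs.
    4 * (P * W) + 4 * (W * P) + 6 * (m * W) + 6 * (m * W) + 4 * m + 4 * m + m * 36 + 6 * m ≡⟨ rhs m P W ⟩
    8 * (P * W) + 12 * (m * W) + 50 * m       ∎
    where
    open ≤-Reasoning
    lhs : ∀ m W → 18 * (m * m) + 9 * (W * W) ≡ 2 * (3 * m * (3 * m)) + 9 * (W * W)
    lhs = solve-∀
    mid : ∀ m W Q → 2 * (2 * Q + 3 * m) + 9 * (W * W) ≡ 4 * Q + 9 * (W * W) + 6 * m
    mid = solve-∀
    rhs : ∀ m P W → 4 * (P * W) + 4 * (W * P) + 6 * (m * W) + 6 * (m * W) + 4 * m + 4 * m + m * 36 + 6 * m ≡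
                    8 * (P * W) + 12 * (m * W) + 50 * m
    rhs = solve-∀
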